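{- Let $n\ge 3$, $1\le t<n$, and let $c_1,c_2,\ldots,c_t\in[n]$ be distinct integers such that the sequence $(c_1,\ldots,c_t)$ avoids both patterns $123$ and $231$. If $(c_1,\ldots,c_t)=(n,n-1,\ldots,n-t+1)$, then $$|S_{n,(c_1,\ldots,c_t)}(123,231)|=\binom{n-t}{2}+1;$$ otherwise, $|S_{n,(c_1,\ldots,c_t)}(123,231)|\in\{0,1\}$.
   Context: $[n]=\{1,\ldots,n\}$ and $S_n$ is the set of permutations of $[n]$ written as sequences $(\tau(1),\ldots,\tau(n))$. A sequence of distinct integers $\tau=(\tau(1),\ldots,\tau(m))$ contains $\sigma\in S_k$ as a pattern if there are indices $1\le i_1<\cdots<i_k\le m$ such that for all $1\le a<b\le k$, $\tau(i_a)<\tau(i_b)$ if and only if $\sigma(a)<\sigma(b)$; otherwise $\tau$ avoids $\sigma$. $S_{n,(c_1,\ldots,c_t)}(\sigma_1,\ldots,\sigma_m)$ is the set of $\tau\in S_n$ with $(\tau(1),\ldots,\tau(t))=(c_1,\ldots,c_t)$ that avoid all of $\sigma_1,\ldots,\sigma_m$. -}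

module Defs where

open import Data.Fin.Base using (Fin; _<_; inject≤; opposite)
open import Data.Fin.Patterns using (0F; 1F; 2F)
open import Data.List.Base using (List; length)
open import Data.List.Membership.Propositional using (_∈_)
open import Data.List.Relation.Unary.All using (All)
open import Data.List.Relation.Unary.Unique.Propositional using (Unique)
open import Data.Nat.Base using (ℕ; _≤_)
open import Data.Product.Base using (Σ; ∃; _×_; _,_)
open import Data.Vec.Base using (Vec; []; _∷_; lookup; tabulate; truncate)
open import Function.Bundles using (_⇔_)
open import Function.Definitions using (Injective; Bijective)
open import Relation.Binary.PropositionalEquality.Core using (_≡_)
open import Relation.Nullary.Negation.Core using (¬_)

-- Positions and values are both counted from 0: the element i of Fin n
-- stands for the element i + 1 of [n] = {1, …, n}.

Distinct : ∀ {n m} → Vec (Fin n) m → Set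
Distinct τ = Injective _≡_ _≡_ (lookup τ)

IsPermutation : ∀ {n} → Vec (Fin n) n → Set
IsPermutation τ = Bijective _≡_ _≡_ (lookup τ)

Contains : ∀ {n m k} → Vec (Fin n) m → Vec (Fin k) k → Set
Contains {m = m} {k} τ σ =
  Σ (Fin k → Fin m) λ i →
    (∀ {a b} → a < b → i a < i b) ×
    (∀ {a b} → a < b →
      (lookup τ (i a) < lookup τ (i b)) ⇔ (lookup σ a < lookup σ b))

Avoids : ∀ {n m k} → Vec (Fin n) m → Vec (Fin k) k → Set
Avoids τ σ = ¬ Contains τ σ

p123 p231 : Vec (Fin 3) 3
p123 = 0F ∷ 1F ∷ 2F ∷ []
p231 = 1F ∷ 2F ∷ 0F ∷ []

-- S t≤n c σs τ says that τ lies in S_{n,(c₁,…,c_t)}(σ₁,…,σ_m).  The patterns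
-- may have different lengths, so each is paired with its length.

S : ∀ {n t} → t ≤ n → Vec (Fin n) t → List (∃ λ k → Vec (Fin k) k) →
    Vec (Fin n) n → Set
S t≤n c σs τ =
  IsPermutation τ × truncate t≤n τ ≡ c × All (λ (k , σ) → Avoids τ σ) σs

-- (n, n-1, …, n-t+1); opposite sends the 0-based i to n - 1 - i.

descending : ∀ {n t} → t ≤ n → Vec (Fin n) t
descending t≤n = tabulate λ i → opposite (inject≤ i t≤n)

-- The subset P of A is finite with exactly k elements.

HasCardinality : {A : Set} → (A → Set) → ℕ → Set
HasCardinality {A} P k =
  Σ (List A) λ xs → Unique xs × (∀ x → (x ∈ xs) ⇔ P x) × length xs ≡ k

{-# OPTIONS --safe #-}

-- Let p be the least start of an ascent (a pair i < j with τ i < τ j) of an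
-- avoider τ and q the least end of an ascent from p.  Avoidance of 123 and 231
-- forces the ascents of τ to be exactly the pairs with p ≤ i < q ≤ j, and a
-- permutation is determined by its ascents.  So besides the decreasing
-- permutation there is one avoider for every p < q, and it agrees with the
-- decreasing one on the positions before p, but not at p.  Hence its prefix of
-- length t is descending iff t ≤ p; otherwise that prefix contains position p,
-- whose entry gives q.

module Submission where

open import Defs
open import Data.Fin.Base as Fin
  using (Fin; zero; suc; toℕ; fromℕ<; inject≤; opposite)
open import Data.Fin.Patterns using (0F; 1F; 2F)
open import Data.Fin.Properties as Fin
  using (toℕ-injective; toℕ<n; toℕ-fromℕ<; fromℕ<-toℕ; toℕ-inject≤;
         opposite-prop; any?; punchOut-injective; injective⇒≤)
open import Data.List.Base
  using (List; []; _∷_; _++_; length; map; filter; applyUpTo)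
open import Data.List.Membership.Propositional using (_∈_)
open import Data.List.Membership.Propositional.Properties
  using (∈-++⁺ˡ; ∈-++⁺ʳ; ∈-++⁻; ∈-applyUpTo⁺; ∈-applyUpTo⁻; ∈-map⁺; ∈-map⁻;
         ∈-filter⁺; ∈-filter⁻)
open import Data.List.Properties using (length-++; length-applyUpTo; length-map)
open import Data.List.Relation.Unary.All as All using (All; []; _∷_)
import Data.List.Relation.Unary.All.Properties as All
open import Data.List.Relation.Unary.AllPairs using ([]; _∷_)
open import Data.List.Relation.Unary.Any using (here; there)
open import Data.List.Relation.Unary.Unique.Propositional using (Unique)
import Data.List.Relation.Unary.Unique.Propositional.Properties as Unique
open import Data.Nat.Base
  using (ℕ; zero; suc; _+_; _∸_; _≤_; _<_; z≤n; s≤s; z<s; s<s)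
open import Data.Nat.Combinatorics using (_C_; nC1≡n; nCk+nC[k+1]≡[n+1]C[k+1])
open import Data.Nat.Properties
open import Data.Product.Base using (∃; ∃₂; _×_; _,_; proj₁; proj₂; uncurry)
open import Data.Product.Properties using (,-injectiveˡ)
open import Data.Sum.Base using (_⊎_; inj₁; inj₂)
open import Data.Vec.Base using (Vec; []; _∷_; lookup; tabulate; truncate)
open import Data.Vec.Properties
  using (lookup∘tabulate; lookup-truncate; ≡-dec)
open import Data.Vec.Relation.Binary.Pointwise.Extensional using (ext; Pointwise-≡⇒≡)
open import Function.Base using (_∘_)
open import Function.Bundles using (_⇔_; mk⇔; Equivalence)
open import Function.Definitions using (Injective; Surjective)
open import Relation.Binary.Definitions using (tri<; tri≈; tri>)
open import Relation.Binary.PropositionalEquality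
  using (_≡_; _≢_; _≗_; refl; sym; trans; cong; cong₂; subst; subst₂; module ≡-Reasoning)
open import Relation.Nullary using (¬_; Dec; yes; no; contradiction; _×-dec_)
open import Relation.Unary using (Decidable)

open Equivalence using (to; from)

private
  variable
    n t p q p′ q′ : ℕ

-- Extensionality, least elements, injective and order-preserving maps.

vec-ext : {A : Set} {xs ys : Vec A n} → lookup xs ≗ lookup ys → xs ≡ ys
vec-ext eq = Pointwise-≡⇒≡ (ext eq)

least : {P : Fin n → Set} → Decidable P → ∃ P →
        ∃ λ i → P i × (∀ {j} → P j → i Fin.≤ j)
least P? (zero , P0) = zero , P0 , λ _ → z≤n
least P? (suc i , Pi) with P? zero
... | yes P0 = zero , P0 , λ _ → z≤n
... | no ¬P0 with least (P? ∘ suc) (i , Pi)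
...   | j , Pj , min = suc j , Pj , λ
        { {zero}  P0 → contradiction P0 ¬P0
        ; {suc k} Pk → s≤s (min Pk)
        }

-- A missed value could be punched out, leaving an injection from `Fin (suc n)` into `Fin n`.
injective⇒surjective : {f : Fin n → Fin n} →
                       Injective _≡_ _≡_ f → Surjective _≡_ _≡_ f
injective⇒surjective {suc n} {f} inj y with any? (λ x → f x Fin.≟ y)
... | yes (x , fx≡y) = x , λ { refl → fx≡y }
... | no y∉f = contradiction (injective⇒≤ {f = λ x → Fin.punchOut (y≢f x)}
                 (λ eq → inj (punchOut-injective (y≢f _) (y≢f _) eq))) (<⇒≱ ≤-refl)
  where
  y≢f : ∀ x → y ≢ f x
  y≢f x y≡fx = y∉f (x , sym y≡fx)

-- All values below `f i` are attained by `f`, and `g` turns them into a strictly increasing chain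
-- below `g i`. The induction descends to the position whose `f`-value is one less.
order-preserving⇒≤ : {f g : Fin n → Fin n} → Surjective _≡_ _≡_ f →
  (∀ {i j} → f i Fin.< f j → g i Fin.< g j) → ∀ i → f i Fin.≤ g i
order-preserving⇒≤ {n} {f} {g} surj mono i = go _ i refl
  where
  go : ∀ k i → toℕ (f i) ≡ k → k ≤ toℕ (g i)
  go zero    i fi≡k  = z≤n
  go (suc k) i fi≡1+k =
    ≤-trans (s≤s (go k j fj≡k))
            (mono (subst₂ _<_ (sym fj≡k) (sym fi≡1+k) ≤-refl))
    where
    k<n : k < n
    k<n = <-trans ≤-refl (subst (_< n) fi≡1+k (toℕ<n (f i)))
    j : Fin n
    j = proj₁ (surj (fromℕ< k<n))
    fj≡k : toℕ (f j) ≡ k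
    fj≡k = trans (cong toℕ (proj₂ (surj (fromℕ< k<n)) refl)) (toℕ-fromℕ< k<n)

-- Permutations and their ascents.

-- "Ascent" means any pair of positions i < j with f i < f j, adjacent or not.

Ascents : (Fin n → Fin n) → ℕ → ℕ → Set
Ascents f p q = ∀ {i j} → i Fin.< j →
  (f i Fin.< f j) ⇔ ((p ≤ toℕ i × toℕ i < q) × q ≤ toℕ j)

module _ {f g : Fin n → Fin n} (g-inj : Injective _≡_ _≡_ g)
         (f-asc : Ascents f p q) (g-asc : Ascents g p q) where

  ascents⇒order-preserving : ∀ {i j} → f i Fin.< f j → g i Fin.< g j
  ascents⇒order-preserving {i} {j} fi<fj with Fin.<-cmp i j
  ... | tri< i<j _ _  = from (g-asc i<j) (to (f-asc i<j) fi<fj)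
  ... | tri≈ _ refl _ = contradiction fi<fj (<-irrefl refl)
  ... | tri> _ i≢j j<i with Fin.<-cmp (g i) (g j)
  ...   | tri< gi<gj _ _ = gi<gj
  ...   | tri≈ _ gi≡gj _ = contradiction (g-inj gi≡gj) i≢j
  -- An ascent of `g` from `j` to `i` would be one of `f` too, by the common description.
  ...   | tri> _ _ gj<gi =
    contradiction (from (f-asc j<i) (to (g-asc j<i) gj<gi)) (<-asym fi<fj)

ascents-determine : {f g : Fin n → Fin n} →
  Injective _≡_ _≡_ f → Injective _≡_ _≡_ g →
  Ascents f p q → Ascents g p q → f ≗ g
ascents-determine f-inj g-inj f-asc g-asc i = toℕ-injective (≤-antisym
  (order-preserving⇒≤ (injective⇒surjective f-inj)
    (ascents⇒order-preserving g-inj f-asc g-asc) i)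
  (order-preserving⇒≤ (injective⇒surjective g-inj)
    (ascents⇒order-preserving f-inj g-asc f-asc) i))

-- The positions `p` and `q` themselves form an ascent, on which the second description is tested.
ascent-bounds : {f : Fin n → Fin n} → Ascents f p q → Ascents f p′ q′ →
  p < q → q < n → (p′ ≤ p × p < q′) × q′ ≤ q
ascent-bounds {n} {p} {q} {p′} {q′} asc asc′ p<q q<n =
  subst₂ (λ i j → (p′ ≤ i × i < q′) × q′ ≤ j) i≡p j≡q
    (to (asc′ i<j) (from (asc i<j)
      ((≤-reflexive (sym i≡p) , subst (_< q) (sym i≡p) p<q) , ≤-reflexive (sym j≡q))))
  where
  i≡p = toℕ-fromℕ< (<-trans p<q q<n)
  j≡q = toℕ-fromℕ< q<n
  i<j : fromℕ< (<-trans p<q q<n) Fin.< fromℕ< q<n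
  i<j = subst₂ _<_ (sym i≡p) (sym j≡q) p<q

-- Avoidance of the two patterns in terms of ascents.

module _ (τ : Vec (Fin n) n) (asc : Ascents (lookup τ) p q) where

  -- The middle entry ends one ascent and starts another, so its position would be both at least `q`
  -- and below `q`.
  ascents⇒avoids-123 : Avoids τ p123
  ascents⇒avoids-123 (i , i-mono , iff)
    with to (asc (i-mono {0F} {1F} z<s)) (from (iff {0F} {1F} z<s) z<s)
       | to (asc (i-mono {1F} {2F} (s<s z<s))) (from (iff {1F} {2F} (s<s z<s)) (s<s z<s))
  ... | _ , q≤i₁ | (_ , i₁<q) , _ = <⇒≱ i₁<q q≤i₁

  -- The ascent from `i 0F` to `i 1F` puts `i 1F`, hence also `i 2F`, at or beyond `q`. So `i 0F`
  -- and `i 2F` form an ascent, where 231 has a descent.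
  ascents⇒avoids-231 : Avoids τ p231
  ascents⇒avoids-231 (i , i-mono , iff)
    with to (asc (i-mono {0F} {1F} z<s)) (from (iff {0F} {1F} z<s) (s<s z<s))
  ... | p≤i₀<q , q≤i₁
    with () ← to (iff {0F} {2F} z<s) (from (asc (i-mono z<s))
           (p≤i₀<q , ≤-trans q≤i₁ (<⇒≤ (i-mono {1F} {2F} (s<s z<s)))))

module _ (τ : Vec (Fin n) n) {i j k : Fin n} (i<j : i Fin.< j) (j<k : j Fin.< k) where

  private
    at : Fin 3 → Fin n
    at 0F = i
    at 1F = j
    at 2F = k

    at-mono : ∀ {a b} → a Fin.< b → at a Fin.< at b
    at-mono {0F} {1F} _ = i<j
    at-mono {0F} {2F} _ = <-trans i<j j<k
    at-mono {1F} {2F} _ = j<k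
    at-mono {1F} {1F} (s<s ())
    at-mono {2F} {1F} (s<s ())
    at-mono {2F} {2F} (s<s (s<s ()))

  contains-123 : lookup τ i Fin.< lookup τ j → lookup τ j Fin.< lookup τ k →
                 Contains τ p123
  contains-123 τi<τj τj<τk = at , at-mono , λ
    { {0F} {1F} _ → mk⇔ (λ _ → z<s) (λ _ → τi<τj)
    ; {0F} {2F} _ → mk⇔ (λ _ → z<s) (λ _ → <-trans τi<τj τj<τk)
    ; {1F} {2F} _ → mk⇔ (λ _ → s<s z<s) (λ _ → τj<τk)
    ; {1F} {1F} (s<s ())
    ; {2F} {1F} (s<s ())
    ; {2F} {2F} (s<s (s<s ()))
    }

  contains-231 : lookup τ i Fin.< lookup τ j → lookup τ k Fin.< lookup τ i →
                 Contains τ p231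
  contains-231 τi<τj τk<τi = at , at-mono , λ
    { {0F} {1F} _ → mk⇔ (λ _ → s<s z<s) (λ _ → τi<τj)
    ; {0F} {2F} _ → mk⇔ (λ τi<τk → contradiction τk<τi (<-asym τi<τk)) (λ ())
    ; {1F} {2F} _ → mk⇔ (λ τj<τk → contradiction (<-trans τk<τi τi<τj) (<-asym τj<τk)) (λ ())
    ; {1F} {1F} (s<s ())
    ; {2F} {1F} (s<s ())
    ; {2F} {2F} (s<s (s<s ()))
    }

module _ (τ : Vec (Fin n) n) (inj : Distinct τ)
         (avoids-123 : Avoids τ p123) (avoids-231 : Avoids τ p231) where

  private
    Ascent : Fin n → Fin n → Set
    Ascent i j = i Fin.< j × lookup τ i Fin.< lookup τ j

    Ascent? : ∀ i → Decidable (Ascent i)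
    Ascent? i j = i Fin.<? j ×-dec lookup τ i Fin.<? lookup τ j

    ≮⇒> : ∀ {i j} → i ≢ j → ¬ lookup τ i Fin.< lookup τ j → lookup τ j Fin.< lookup τ i
    ≮⇒> i≢j τi≮τj = ≤∧≢⇒< (≮⇒≥ τi≮τj) (λ eq → i≢j (inj (sym (toℕ-injective eq))))

  -- If p is the least start of an ascent and q the least end of an ascent from
  -- p, then 123-avoidance makes τ decrease on [p, q) and on [q, n), and
  -- 231-avoidance puts the values on [q, n) above those on [p, q).

  avoids⇒ascents : Ascents (lookup τ) 0 0 ⊎
    ∃₂ λ p q → p < q × q < n × Ascents (lookup τ) p q
  avoids⇒ascents with any? (λ i → any? (Ascent? i))
  -- The case without ascents is `p = q = 0`, since `i < 0` never holds.
  ... | no none = inj₁ λ i<j →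
        mk⇔ (λ τi<τj → contradiction (_ , _ , i<j , τi<τj) none) (λ ())
  ... | yes some with least (λ i → any? (Ascent? i)) some
  ... | p , from-p , p-least with least (Ascent? p) from-p
  ... | q , (p<q , τp<τq) , q-least =
    inj₂ (toℕ p , toℕ q , p<q , toℕ<n q , λ i<j → mk⇔ (forward i<j) (backward i<j))
    where
    τp<τ : ∀ {j} → q Fin.≤ j → lookup τ p Fin.< lookup τ j
    τp<τ {j} q≤j with Fin.<-cmp q j
    ... | tri> _ _ j<q = contradiction q≤j (<⇒≱ j<q)
    ... | tri≈ _ refl _ = τp<τq
    ... | tri< q<j _ _ with lookup τ p Fin.<? lookup τ j
    ...   | yes τp<τj = τp<τj
    ...   | no τp≮τj = contradiction
              (contains-231 τ p<q q<j τp<τq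
                (≮⇒> (λ { refl → <⇒≱ p<q q≤j }) τp≮τj))
              avoids-231

    τ≤τp : ∀ {i} → p Fin.≤ i → i Fin.< q → lookup τ i Fin.≤ lookup τ p
    τ≤τp {i} p≤i i<q with Fin.<-cmp p i
    ... | tri> _ _ i<p = contradiction p≤i (<⇒≱ i<p)
    ... | tri≈ _ refl _ = ≤-refl
    ... | tri< p<i _ _ = ≮⇒≥ λ τp<τi → <⇒≱ i<q (q-least (p<i , τp<τi))

    forward : ∀ {i j} → i Fin.< j → lookup τ i Fin.< lookup τ j →
              (p Fin.≤ i × i Fin.< q) × q Fin.≤ j
    forward {i} {j} i<j τi<τj = (p≤i , ≰⇒> q≰i) , ≮⇒≥ j≮q
      where
      p≤i : p Fin.≤ i
      p≤i = p-least (j , i<j , τi<τj)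
      q≰i : ¬ q Fin.≤ i
      q≰i q≤i = avoids-123 (contains-123 τ (<-≤-trans p<q q≤i) i<j (τp<τ q≤i) τi<τj)
      j≮q : ¬ j Fin.< q
      -- The value at `j` is at most the one at `p`, so the larger entry at `q` completes a 123.
      j≮q j<q = avoids-123 (contains-123 τ i<j j<q τi<τj
        (≤-<-trans (τ≤τp (≤-trans p≤i (<⇒≤ i<j)) j<q) τp<τq))

    backward : ∀ {i j} → i Fin.< j → (p Fin.≤ i × i Fin.< q) × q Fin.≤ j →
               lookup τ i Fin.< lookup τ j
    backward _ ((p≤i , i<q) , q≤j) = ≤-<-trans (τ≤τp p≤i i<q) (τp<τ q≤j)

-- The permutations `layered n p q`, built from a block exchange.

-- For `p ≤ q ≤ n` this exchanges the adjacent blocks [p, q) and [q, n). Its inversions are the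
-- pairs with one position in each block; composition with `opposite` turns them into the ascents.
rotate : (n p q i : ℕ) → ℕ
rotate n p q i with i <? p | i <? q
... | yes _ | _     = i
... | no _  | yes _ = i + (n ∸ q)
... | no _  | no _  = i ∸ (q ∸ p)

rotate-< : ∀ n p q {i} → i < n → rotate n p q i < n
rotate-< n p q {i} i<n with i <? p | i <? q
... | yes _ | _      = i<n
... | no _  | no _   = ≤-<-trans (m∸n≤m i (q ∸ p)) i<n
... | no _  | yes i<q with ≤-total q n
...   | inj₁ q≤n = <-≤-trans (+-monoˡ-< (n ∸ q) i<q) (≤-reflexive (m+[n∸m]≡n q≤n))
-- Here the truncated shift `n ∸ q` is zero.
...   | inj₂ n≤q = subst (_< n) (sym (trans (cong (i +_) (m≤n⇒m∸n≡0 n≤q)) (+-identityʳ i))) i<n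

rotate-fixes : ∀ n p q {i} → i < p → rotate n p q i ≡ i
rotate-fixes n p q {i} i<p with i <? p
... | yes _  = refl
... | no i≮p = contradiction i<p i≮p

-- This value reveals `q`, which is how a prefix containing position `p` fixes the permutation.
rotate-start : ∀ n p q → p < q → rotate n p q p ≡ p + (n ∸ q)
rotate-start n p q p<q with p <? p | p <? q
... | yes p<p | _      = contradiction p<p (<-irrefl refl)
... | no _    | yes _  = refl
... | no _    | no p≮q = contradiction p<q p≮q

rotate-descent : ∀ n p q {i j} → (p ≤ i × i < q) × q ≤ j → j < n →
                 rotate n p q j < rotate n p q i
rotate-descent n p q {i} {j} ((p≤i , i<q) , q≤j) j<n
  with i <? p | i <? q | j <? p | j <? q
... | yes i<p | _      | _       | _       = contradiction p≤i (<⇒≱ i<p)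
... | no _    | no i≮q | _       | _       = contradiction i<q i≮q
... | no _    | yes _  | yes j<p | _       =
  contradiction (≤-trans p≤i (<⇒≤ (<-≤-trans i<q q≤j))) (<⇒≱ j<p)
... | no _    | yes _  | no _    | yes j<q = contradiction q≤j (<⇒≱ j<q)
-- The separating value `n ∸ (q ∸ p)` equals `p + (n ∸ q)`, the least value taken on [p, q).
... | no _    | yes _  | no _    | no _    = begin-strict
  j ∸ (q ∸ p)  <⟨ ∸-monoˡ-< j<n (≤-trans (m∸n≤m q p) q≤j) ⟩
  n ∸ (q ∸ p)  ≤⟨ m≤n+o⇒m∸n≤o n (q ∸ p) n≤ ⟩
  i + (n ∸ q)  ∎
  where
  open ≤-Reasoning
  n≤ : n ≤ (q ∸ p) + (i + (n ∸ q))
  n≤ = begin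
    n                        ≡⟨ m+[n∸m]≡n (<⇒≤ (≤-<-trans q≤j j<n)) ⟨
    q + (n ∸ q)              ≡⟨ cong (_+ (n ∸ q)) (m∸n+n≡m (<⇒≤ (≤-<-trans p≤i i<q))) ⟨
    (q ∸ p) + p + (n ∸ q)    ≤⟨ +-monoˡ-≤ (n ∸ q) (+-monoʳ-≤ (q ∸ p) p≤i) ⟩
    (q ∸ p) + i + (n ∸ q)    ≡⟨ +-assoc (q ∸ p) i (n ∸ q) ⟩
    (q ∸ p) + (i + (n ∸ q))  ∎

rotate-mono : ∀ n p q {i j} → p ≤ q → i < j → ¬ ((p ≤ i × i < q) × q ≤ j) →
              rotate n p q i < rotate n p q j
rotate-mono n p q {i} {j} p≤q i<j outside
  with i <? p | i <? q | j <? p | j <? q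
... | yes _   | _       | yes _   | _       = i<j
... | yes _   | _       | no _    | yes _   = ≤-trans i<j (m≤m+n j (n ∸ q))
-- Subtracting `q ∸ p` from `j`, which is at least `q`, leaves at least `p`, hence more than `i`.
... | yes i<p | _       | no _    | no j≮q  = m+n≤o⇒m≤o∸n (suc i) (begin
  suc i + (q ∸ p)  ≤⟨ +-monoˡ-≤ (q ∸ p) i<p ⟩
  p + (q ∸ p)      ≡⟨ m+[n∸m]≡n p≤q ⟩
  q                ≤⟨ ≮⇒≥ j≮q ⟩
  j                ∎)
  where open ≤-Reasoning
... | no i≮p  | _       | yes j<p | _       = contradiction (<-trans i<j j<p) i≮p
... | no _    | yes _   | no _    | yes _   = +-monoˡ-< (n ∸ q) i<j
... | no i≮p  | yes i<q | no _    | no j≮q  =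
  contradiction ((≮⇒≥ i≮p , i<q) , ≮⇒≥ j≮q) outside
... | no _    | no i≮q  | no _    | yes j<q = contradiction (<-trans i<j j<q) i≮q
... | no _    | no i≮q  | no _    | no _    =
  ∸-monoˡ-< i<j (≤-trans (m∸n≤m q p) (≮⇒≥ i≮q))

-- In 1-based terms the entries are n, …, n-p+1, then q-p, …, 1, then
-- n-p, …, q-p+1: three decreasing runs.

layered : ∀ n → ℕ → ℕ → Vec (Fin n) n
layered n p q = tabulate λ i → opposite (fromℕ< (rotate-< n p q (toℕ<n i)))

opposite-< : {i j : Fin n} → i Fin.< j → opposite j Fin.< opposite i
opposite-< {i = i} {j} i<j = subst₂ _<_ (sym (opposite-prop j)) (sym (opposite-prop i))
  (∸-monoʳ-< (s≤s i<j) (toℕ<n j))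

opposite-injective : Injective _≡_ _≡_ (opposite {n})
opposite-injective {n} {i} {j} eq = trans (sym (Fin.opposite-involutive i))
  (trans (cong opposite eq) (Fin.opposite-involutive j))

module _ (p q : ℕ) where

  lookup-layered : (i : Fin n) →
    lookup (layered n p q) i ≡ opposite (fromℕ< (rotate-< n p q (toℕ<n i)))
  lookup-layered i = lookup∘tabulate _ i

  rotate-reverses : {i j : Fin n} → rotate n p q (toℕ i) < rotate n p q (toℕ j) →
    lookup (layered n p q) j Fin.< lookup (layered n p q) i
  rotate-reverses {n} {i} {j} r = subst₂ Fin._<_ (sym (lookup-layered j)) (sym (lookup-layered i))
    (opposite-< (subst₂ _<_ (sym (toℕ-fromℕ< (rotate-< n p q (toℕ<n i))))
                            (sym (toℕ-fromℕ< (rotate-< n p q (toℕ<n j)))) r))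

  module _ (p≤q : p ≤ q) where

    private
      inside? : ∀ i j → Dec ((p ≤ i × i < q) × q ≤ j)
      inside? i j = (p ≤? i ×-dec i <? q) ×-dec q ≤? j

    layered-ascents : Ascents (lookup (layered n p q)) p q
    layered-ascents {n} {i} {j} i<j = mk⇔ forward
      (λ inside → rotate-reverses (rotate-descent n p q inside (toℕ<n j)))
      where
      forward : lookup (layered n p q) i Fin.< lookup (layered n p q) j → _
      forward asc with inside? (toℕ i) (toℕ j)
      ... | yes inside  = inside
      ... | no outside = contradiction asc
              (<-asym (rotate-reverses (rotate-mono n p q p≤q i<j outside)))

    -- Each pair of positions falls under `rotate-descent` or `rotate-mono`, and both are strict.
    layered-separates : {i j : Fin n} → i Fin.< j →
                        lookup (layered n p q) i ≢ lookup (layered n p q) j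
    layered-separates {n} {i} {j} i<j with inside? (toℕ i) (toℕ j)
    ... | yes inside = Fin.<⇒≢ (rotate-reverses (rotate-descent n p q inside (toℕ<n j)))
    ... | no outside = Fin.<⇒≢ (rotate-reverses (rotate-mono n p q p≤q i<j outside)) ∘ sym

    layered-distinct : Distinct (layered n p q)
    layered-distinct {n} {i} {j} eq with Fin.<-cmp i j
    ... | tri< i<j _ _ = contradiction eq (layered-separates i<j)
    ... | tri≈ _ i≡j _ = i≡j
    ... | tri> _ _ j<i = contradiction (sym eq) (layered-separates j<i)

-- Comparison of prefixes.

layered-agree : ∀ p q p′ q′ (i : Fin n) →
  (lookup (layered n p q) i ≡ lookup (layered n p′ q′) i) ⇔
  (rotate n p q (toℕ i) ≡ rotate n p′ q′ (toℕ i))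
layered-agree {n} p q p′ q′ i = mk⇔
  (λ eq → subst₂ _≡_ (toℕ-fromℕ< b) (toℕ-fromℕ< b′) (cong toℕ (opposite-injective
    (subst₂ _≡_ (lookup-layered p q i) (lookup-layered p′ q′ i) eq))))
  (λ eq → subst₂ _≡_ (sym (lookup-layered p q i)) (sym (lookup-layered p′ q′ i))
    (cong opposite (toℕ-injective
      (subst₂ _≡_ (sym (toℕ-fromℕ< b)) (sym (toℕ-fromℕ< b′)) eq))))
  where
  b  = rotate-< n p  q  (toℕ<n i)
  b′ = rotate-< n p′ q′ (toℕ<n i)

truncate-agree : (t≤n : t ≤ n) {τ σ : Vec (Fin n) n} →
  (truncate t≤n τ ≡ truncate t≤n σ) ⇔ (∀ i → toℕ i < t → lookup τ i ≡ lookup σ i)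
truncate-agree {t} {n} t≤n {τ} {σ} = mk⇔ forward λ agree → vec-ext λ i →
  trans (lookup-truncate t≤n τ i)
    (trans (agree (inject≤ i t≤n) (subst (_< t) (sym (toℕ-inject≤ i t≤n)) (toℕ<n i)))
      (sym (lookup-truncate t≤n σ i)))
  where
  forward : truncate t≤n τ ≡ truncate t≤n σ → ∀ i → toℕ i < t → lookup τ i ≡ lookup σ i
  forward eq i i<t = subst (λ k → lookup τ k ≡ lookup σ k)
    (toℕ-injective (trans (toℕ-inject≤ (fromℕ< i<t) t≤n) (toℕ-fromℕ< i<t)))
    (trans (sym (lookup-truncate t≤n τ (fromℕ< i<t)))
      (trans (cong (λ v → lookup v (fromℕ< i<t)) eq) (lookup-truncate t≤n σ (fromℕ< i<t))))

-- Reduces equality of prefixes to arithmetic on ℕ.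
truncate-layered-agree : (t≤n : t ≤ n) → ∀ p q p′ q′ →
  (truncate t≤n (layered n p q) ≡ truncate t≤n (layered n p′ q′)) ⇔
  (∀ i → i < t → rotate n p q i ≡ rotate n p′ q′ i)
truncate-layered-agree {t} {n} t≤n p q p′ q′ = mk⇔
  (λ eq i i<t → let i<n = <-≤-trans i<t t≤n in
    subst (λ k → rotate n p q k ≡ rotate n p′ q′ k) (toℕ-fromℕ< i<n)
      (to (layered-agree p q p′ q′ (fromℕ< i<n))
        (to (truncate-agree t≤n) eq (fromℕ< i<n) (subst (_< t) (sym (toℕ-fromℕ< i<n)) i<t))))
  (λ agree → from (truncate-agree t≤n)
    (λ i i<t → from (layered-agree p q p′ q′ i) (agree (toℕ i) i<t)))

-- `rotate n 0 0` computes to the identity, so `layered n 0 0` is the decreasing permutation.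
descending≡truncate : (t≤n : t ≤ n) → descending t≤n ≡ truncate t≤n (layered n 0 0)
descending≡truncate {t} {n} t≤n = vec-ext λ i → begin
  lookup (descending t≤n) i                   ≡⟨ lookup∘tabulate _ i ⟩
  opposite (inject≤ i t≤n)                    ≡⟨ cong opposite (fromℕ<-toℕ _ _) ⟨
  opposite (fromℕ< (toℕ<n (inject≤ i t≤n)))   ≡⟨ lookup-layered 0 0 (inject≤ i t≤n) ⟨
  lookup (layered n 0 0) (inject≤ i t≤n)      ≡⟨ lookup-truncate t≤n _ i ⟨
  lookup (truncate t≤n (layered n 0 0)) i     ∎
  where open ≡-Reasoning

rotate-moves-start : p < q → q < n → rotate n p q p ≢ p
rotate-moves-start {p} {q} {n} p<q q<n eq =
  <⇒≢ (subst (p <_) (sym (rotate-start n p q p<q)) (m<m+n p (m<n⇒0<n∸m q<n))) (sym eq)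

-- Position `p` is the first one that `rotate n p q` moves, so a prefix shows the difference exactly
-- when it contains `p`.
truncate-layered-descending : (t≤n : t ≤ n) → p < q → q < n →
  (truncate t≤n (layered n p q) ≡ descending t≤n) ⇔ (t ≤ p)
truncate-layered-descending {t} {n} {p} {q} t≤n p<q q<n
  rewrite descending≡truncate t≤n = mk⇔
  (λ eq → ≮⇒≥ λ p<t →
    rotate-moves-start p<q q<n (to (truncate-layered-agree t≤n p q 0 0) eq p p<t))
  (λ t≤p → from (truncate-layered-agree t≤n p q 0 0)
    λ i i<t → rotate-fixes n p q (<-≤-trans i<t t≤p))

-- If `p` and `p′` differ, the smaller is moved by one rotation and fixed by the other. Once they
-- agree, cancelling in `p + (n ∸ q)` gives `q`.
rotate-determined : p < q → q < n → p′ < q′ → q′ < n → p < t → p′ < t →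
  (∀ i → i < t → rotate n p q i ≡ rotate n p′ q′ i) → p ≡ p′ × q ≡ q′
rotate-determined {p} {q} {n} {p′} {q′} p<q q<n p′<q′ q′<n p<t p′<t agree with <-cmp p p′
... | tri< p<p′ _ _ = contradiction
        (trans (agree p p<t) (rotate-fixes n p′ q′ p<p′)) (rotate-moves-start p<q q<n)
... | tri> _ _ p′<p = contradiction
        (trans (sym (agree p′ p′<t)) (rotate-fixes n p q p′<p)) (rotate-moves-start p′<q′ q′<n)
... | tri≈ _ refl _ = refl , ∸-cancelˡ-≡ (<⇒≤ q<n) (<⇒≤ q′<n) (+-cancelˡ-≡ p _ _
        (trans (sym (rotate-start n p q p<q)) (trans (agree p p<t) (rotate-start n p q′ p′<q′))))

-- Classification of the avoiders.

-- The bound `t ≤ p` expresses a descending prefix of length `t`; with `t = 0` all avoiders are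
-- covered. The decreasing permutation is kept apart, since every code with `p = q` would name it.
Layered : ∀ n → ℕ → Vec (Fin n) n → Set
Layered n t τ = τ ≡ layered n 0 0 ⊎
  ∃₂ λ p q → (t ≤ p × p < q × q < n) × τ ≡ layered n p q

patterns : List (∃ λ k → Vec (Fin k) k)
patterns = (3 , p123) ∷ (3 , p231) ∷ []

Avoider : Vec (Fin n) n → Set
Avoider τ = IsPermutation τ × All (λ (k , σ) → Avoids τ σ) patterns

layered-avoider : p ≤ q → Avoider (layered n p q)
layered-avoider {p} {q} {n} p≤q =
  (layered-distinct p q p≤q , injective⇒surjective (layered-distinct p q p≤q)) ,
  ascents⇒avoids-123 (layered n p q) (layered-ascents p q p≤q) ∷
  ascents⇒avoids-231 (layered n p q) (layered-ascents p q p≤q) ∷ []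

avoider⇔layered : {τ : Vec (Fin n) n} → Avoider τ ⇔ Layered n 0 τ
avoider⇔layered {n} {τ} = mk⇔ forward λ where
    (inj₁ refl)                            → layered-avoider {0} {0} z≤n
    (inj₂ (_ , _ , (_ , p<q , _) , refl)) → layered-avoider (<⇒≤ p<q)
  where
  determined : Distinct τ → p ≤ q → Ascents (lookup τ) p q → τ ≡ layered n p q
  determined {p} {q} inj p≤q asc = vec-ext
    (ascents-determine inj (layered-distinct p q p≤q) asc (layered-ascents p q p≤q))

  forward : Avoider τ → Layered n 0 τ
  forward ((inj , _) , avoids-123 ∷ avoids-231 ∷ [])
    with avoids⇒ascents τ inj avoids-123 avoids-231
  ... | inj₁ asc = inj₁ (determined {0} {0} inj z≤n asc)
  ... | inj₂ (p , q , p<q , q<n , asc) =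
    inj₂ (p , q , (z≤n , p<q , q<n) , determined inj (<⇒≤ p<q) asc)

-- Used in both directions, this recovers `p` and `q` from the permutation.
layered-bounds : p ≤ q → p′ < q′ → q′ < n → layered n p q ≡ layered n p′ q′ →
                 (p ≤ p′ × p′ < q) × q ≤ q′
layered-bounds {p} {q} {p′} {q′} {n} p≤q p′<q′ q′<n eq = ascent-bounds
  (layered-ascents p′ q′ (<⇒≤ p′<q′))
  (subst (λ τ → Ascents (lookup τ) p q) eq (layered-ascents p q p≤q))
  p′<q′ q′<n

-- Enumeration and counting.

-- Grouped by second component, largest first: each step adds one block with a new `q`, so the
-- lengths obey Pascal's rule.
pairs : ℕ → ℕ → List (ℕ × ℕ)
pairs t zero    = []
pairs t (suc m) = applyUpTo (λ x → t + x , t + m) m ++ pairs t m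

∈-pairs : ∀ t m → ((p , q) ∈ pairs t m) ⇔ (t ≤ p × p < q × q < t + m)
∈-pairs t m = mk⇔ (forward m) (λ (t≤p , p<q , q<t+m) → backward m t≤p p<q q<t+m)
  where
  forward : ∀ m → (p , q) ∈ pairs t m → t ≤ p × p < q × q < t + m
  forward (suc m) pq∈ with ∈-++⁻ (applyUpTo (λ x → t + x , t + m) m) pq∈
  ... | inj₁ pq∈ˡ with ∈-applyUpTo⁻ _ pq∈ˡ
  ...   | x , x<m , refl = m≤m+n t x , +-monoʳ-< t x<m , +-monoʳ-< t ≤-refl
  forward (suc m) pq∈ | inj₂ pq∈ʳ with forward m pq∈ʳ
  ...   | t≤p , p<q , q<t+m = t≤p , p<q , <-trans q<t+m (+-monoʳ-< t ≤-refl)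

  backward : ∀ m → t ≤ p → p < q → q < t + m → (p , q) ∈ pairs t m
  backward {p} {q} zero t≤p p<q q<t+0 = contradiction
    (≤-<-trans t≤p (<-trans p<q (subst (q <_) (+-identityʳ t) q<t+0))) (<-irrefl refl)
  backward {p} {q} (suc m) t≤p p<q q<t+1+m
    with m<1+n⇒m<n∨m≡n (subst (q <_) (+-suc t m) q<t+1+m)
  ... | inj₁ q<t+m = ∈-++⁺ʳ _ (backward m t≤p p<q q<t+m)
  ... | inj₂ refl = ∈-++⁺ˡ (subst (λ p → (p , t + m) ∈ applyUpTo (λ x → t + x , t + m) m)
    (m+[n∸m]≡n t≤p) (∈-applyUpTo⁺ (λ x → t + x , t + m) p∸t<m))
    where
    p∸t<m : p ∸ t < m
    p∸t<m = +-cancelˡ-< t _ _ (subst (_< t + m) (sym (m+[n∸m]≡n t≤p)) p<q)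

unique-pairs : ∀ t m → Unique (pairs t m)
unique-pairs t zero    = []
unique-pairs t (suc m) = Unique.++⁺
  (Unique.applyUpTo⁺₁ _ m λ i<j _ eq → <⇒≢ i<j (+-cancelˡ-≡ t _ _ (,-injectiveˡ eq)))
  (unique-pairs t m) disjoint
  where
  disjoint : ∀ {pq} → ¬ (pq ∈ applyUpTo (λ x → t + x , t + m) m × pq ∈ pairs t m)
  disjoint (∈ˡ , ∈ʳ) with ∈-applyUpTo⁻ _ ∈ˡ
  -- The first block has `q = t + m`, while membership in the rest forces `q < t + m`.
  ... | _ , _ , refl = <-irrefl refl (proj₂ (proj₂ (to (∈-pairs t m) ∈ʳ)))

length-pairs : ∀ t m → length (pairs t m) ≡ m C 2
length-pairs t zero    = refl
length-pairs t (suc m) = begin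
  length (pairs t (suc m))                   ≡⟨ length-++ (applyUpTo _ m) ⟩
  length (applyUpTo (λ x → t + x , t + m) m) + length (pairs t m)
    ≡⟨ cong₂ _+_ (length-applyUpTo _ m) (length-pairs t m) ⟩
  m + m C 2                                  ≡⟨ cong (_+ m C 2) (nC1≡n m) ⟨
  m C 1 + m C 2                              ≡⟨ nCk+nC[k+1]≡[n+1]C[k+1] m 1 ⟩
  suc m C 2                                  ∎
  where open ≡-Reasoning

-- Injectivity is asked only on members because `layered n` repeats itself on other codes, such as
-- those with `p = q`.
unique-map : {A B : Set} {f : A → B} (xs : List A) →
  (∀ {x y} → x ∈ xs → y ∈ xs → f x ≡ f y → x ≡ y) → Unique xs → Unique (map f xs)
unique-map []       inj [] = []
unique-map (x ∷ xs) inj (x∉xs ∷ uniq) =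
  All.map⁺ (All.tabulate λ y∈xs eq → All.lookup x∉xs y∈xs (inj (here refl) (there y∈xs) eq)) ∷
  unique-map xs (λ x∈ y∈ → inj (there x∈) (there y∈)) uniq

layered-cardinality : t ≤ n → HasCardinality (Layered n t) ((n ∸ t) C 2 + 1)
layered-cardinality {t} {n} t≤n =
  layered n 0 0 ∷ map (uncurry (layered n)) codes ,
  All.map⁺ (All.tabulate λ pq∈ → decreasing≢ (∈⇒valid pq∈)) ∷
    unique-map codes (λ pq∈ pq′∈ → injective (∈⇒valid pq∈) (∈⇒valid pq′∈))
      (unique-pairs t (n ∸ t)) ,
  (λ τ → mk⇔ forward backward) ,
  (begin
    suc (length (map (uncurry (layered n)) codes)) ≡⟨ cong suc (length-map _ codes) ⟩
    suc (length codes)                             ≡⟨ cong suc (length-pairs t (n ∸ t)) ⟩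
    suc ((n ∸ t) C 2)                              ≡⟨ +-comm 1 _ ⟩
    (n ∸ t) C 2 + 1                                ∎)
  where
  open ≡-Reasoning

  codes : List (ℕ × ℕ)
  codes = pairs t (n ∸ t)

  Valid : ℕ × ℕ → Set
  Valid (p , q) = t ≤ p × p < q × q < n

  ∈⇒valid : ∀ {pq} → pq ∈ codes → Valid pq
  ∈⇒valid pq∈ with to (∈-pairs t (n ∸ t)) pq∈
  ... | t≤p , p<q , q<t+[n∸t] = t≤p , p<q , subst (_ <_) (m+[n∸m]≡n t≤n) q<t+[n∸t]

  decreasing≢ : ∀ {pq} → Valid pq → layered n 0 0 ≢ uncurry (layered n) pq
  decreasing≢ (_ , p<q , q<n) eq
    -- The code `p = q = 0` of the decreasing permutation would put the other code's first component
    -- below 0.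
    with () ← proj₂ (proj₁ (layered-bounds {0} {0} z≤n p<q q<n eq))

  injective : ∀ {pq pq′} → Valid pq → Valid pq′ →
    uncurry (layered n) pq ≡ uncurry (layered n) pq′ → pq ≡ pq′
  injective (_ , p<q , q<n) (_ , p′<q′ , q′<n) eq
    with layered-bounds (<⇒≤ p<q) p′<q′ q′<n eq | layered-bounds (<⇒≤ p′<q′) p<q q<n (sym eq)
  ... | (p≤p′ , _) , q≤q′ | (p′≤p , _) , q′≤q =
    cong₂ _,_ (≤-antisym p≤p′ p′≤p) (≤-antisym q≤q′ q′≤q)

  forward : ∀ {τ} → τ ∈ layered n 0 0 ∷ map (uncurry (layered n)) codes → Layered n t τ
  forward (here eq) = inj₁ eq
  forward (there τ∈) with ∈-map⁻ (uncurry (layered n)) τ∈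
  ... | (p , q) , pq∈ , eq = inj₂ (p , q , ∈⇒valid pq∈ , eq)

  backward : ∀ {τ} → Layered n t τ → τ ∈ layered n 0 0 ∷ map (uncurry (layered n)) codes
  backward (inj₁ eq) = here eq
  backward (inj₂ (p , q , (t≤p , p<q , q<n) , refl)) = there (∈-map⁺ (uncurry (layered n))
    (from (∈-pairs t (n ∸ t)) (t≤p , p<q , subst (q <_) (sym (m+[n∸m]≡n t≤n)) q<n)))

-- Cardinalities of subsets.

module _ {A : Set} {P : A → Set} where

  cardinality-⇔ : {Q : A → Set} → (∀ {x} → P x ⇔ Q x) →
                  ∀ {k} → HasCardinality P k → HasCardinality Q k
  cardinality-⇔ P⇔Q (xs , uniq , iff , len) =
    xs , uniq , (λ x → mk⇔ (to P⇔Q ∘ to (iff x)) (from (iff x) ∘ from P⇔Q)) , len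

  -- The count stays existential, serving only as finiteness input to `cardinality-subsingleton`.
  cardinality-× : {Q : A → Set} → Decidable Q → ∀ {k} → HasCardinality P k →
                  ∃ (HasCardinality (λ x → P x × Q x))
  cardinality-× Q? (xs , uniq , iff , _) =
    _ , filter Q? xs , Unique.filter⁺ Q? uniq , (λ x → mk⇔
      (λ x∈ → let x∈xs , Qx = ∈-filter⁻ Q? x∈ in to (iff x) x∈xs , Qx)
      (λ (Px , Qx) → ∈-filter⁺ Q? (from (iff x) Px) Qx)) , refl

  -- Two listed elements would be equal, against uniqueness of the list.
  cardinality-subsingleton : (∀ {x y} → P x → P y → x ≡ y) → ∀ {k} →
    HasCardinality P k → HasCardinality P 0 ⊎ HasCardinality P 1
  cardinality-subsingleton P! ([] , uniq , iff , _)      = inj₁ ([] , uniq , iff , refl)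
  cardinality-subsingleton P! (x ∷ [] , uniq , iff , _)  = inj₂ (x ∷ [] , uniq , iff , refl)
  cardinality-subsingleton P! (x ∷ y ∷ _ , (x≢y ∷ _) ∷ _ , iff , _) = contradiction
    (P! (to (iff x) (here refl)) (to (iff y) (there (here refl)))) x≢y

-- Avoiders with a prescribed prefix.

layered-with-descending-prefix : (t≤n : t ≤ n) {τ : Vec (Fin n) n} →
  Layered n t τ ⇔ (Layered n 0 τ × truncate t≤n τ ≡ descending t≤n)
layered-with-descending-prefix {t} {n} t≤n = mk⇔
  (λ where
    (inj₁ refl) → inj₁ refl , sym (descending≡truncate t≤n)
    (inj₂ (p , q , (t≤p , p<q , q<n) , refl)) →
      inj₂ (p , q , (z≤n , p<q , q<n) , refl) ,
      from (truncate-layered-descending t≤n p<q q<n) t≤p)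
  (λ where
    (inj₁ refl , _) → inj₁ refl
    (inj₂ (p , q , (_ , p<q , q<n) , refl) , prefix) →
      inj₂ (p , q , (to (truncate-layered-descending t≤n p<q q<n) prefix , p<q , q<n) , refl))

-- A prefix that is not descending excludes the decreasing permutation and forces `p < t`, so both
-- `p` and `q` can be read from it.
layered-determined-by-prefix : (t≤n : t ≤ n) {c : Vec (Fin n) t} → c ≢ descending t≤n →
  {τ σ : Vec (Fin n) n} → Layered n 0 τ × truncate t≤n τ ≡ c →
  Layered n 0 σ × truncate t≤n σ ≡ c → τ ≡ σ
layered-determined-by-prefix t≤n c≢ (inj₁ refl , eq) _ =
  contradiction (trans (sym eq) (sym (descending≡truncate t≤n))) c≢
layered-determined-by-prefix t≤n c≢ _ (inj₁ refl , eq) =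
  contradiction (trans (sym eq) (sym (descending≡truncate t≤n))) c≢
layered-determined-by-prefix {t} {n} t≤n {c} c≢
  (inj₂ (p , q , (_ , p<q , q<n) , refl) , eq)
  (inj₂ (p′ , q′ , (_ , p′<q′ , q′<n) , refl) , eq′)
  with rotate-determined p<q q<n p′<q′ q′<n (start< p<q q<n eq) (start< p′<q′ q′<n eq′)
         (to (truncate-layered-agree t≤n p q p′ q′) (trans eq (sym eq′)))
  where
  start< : ∀ {p q} → p < q → q < n → truncate t≤n (layered n p q) ≡ c → p < t
  start< p<q q<n eq = ≰⇒> λ t≤p →
    c≢ (trans (sym eq) (from (truncate-layered-descending t≤n p<q q<n) t≤p))
... | refl , refl = refl

theorem5p9 : (n t : ℕ) → 3 ≤ n → 1 ≤ t → (t<n : t < n) →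
    (c : Vec (Fin n) t) → Distinct c → Avoids c p123 → Avoids c p231 →
    let Sₙ = S (<⇒≤ t<n) c ((3 , p123) ∷ (3 , p231) ∷ []) in
    (c ≡ descending (<⇒≤ t<n) → HasCardinality Sₙ (((n ∸ t) C 2) + 1)) ×
    (c ≢ descending (<⇒≤ t<n) → HasCardinality Sₙ 0 ⊎ HasCardinality Sₙ 1)
theorem5p9 n t _ _ t<n c _ _ _ = descending-case , other-case
  where
  t≤n : t ≤ n
  t≤n = <⇒≤ t<n

  Prefixed : Vec (Fin n) n → Set
  Prefixed τ = Layered n 0 τ × truncate t≤n τ ≡ c

  prefixed⇔S : ∀ {τ} → Prefixed τ ⇔ S t≤n c patterns τ
  prefixed⇔S = mk⇔
    (λ (lay , eq) → let perm , avoids = from avoider⇔layered lay in perm , eq , avoids)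
    (λ (perm , eq , avoids) → to avoider⇔layered (perm , avoids) , eq)

  descending-case : c ≡ descending t≤n →
    HasCardinality (S t≤n c patterns) ((n ∸ t) C 2 + 1)
  descending-case refl = cardinality-⇔ prefixed⇔S
    (cardinality-⇔ (layered-with-descending-prefix t≤n) (layered-cardinality t≤n))

  other-case : c ≢ descending t≤n →
    HasCardinality (S t≤n c patterns) 0 ⊎ HasCardinality (S t≤n c patterns) 1
  -- The list of all avoiders, obtained with `t = 0`, is filtered by the decidable condition on the
  -- prefix.
  other-case c≢ with cardinality-subsingleton (layered-determined-by-prefix t≤n c≢)
    (proj₂ (cardinality-× {P = Layered n 0} (λ τ → ≡-dec Fin._≟_ (truncate t≤n τ) c)
      (layered-cardinality z≤n)))
  ... | inj₁ card = inj₁ (cardinality-⇔ prefixed⇔S card)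
  ... | inj₂ card = inj₂ (cardinality-⇔ prefixed⇔S card)
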